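{- For every integer $n\ge 10$, $$\tilde r(P_4,P_n)\le \Big\lceil \frac75 n\Big\rceil -1.$$
   Context: $P_t$ denotes the path on $t$ vertices. For finite graphs $G,H$, the game $\tilde R(G,H)$ is played by Builder and Painter on the infinite complete graph $K_{\mathbb N}$ with vertex set $\mathbb N$: in every round Builder chooses a previously unselected edge of $K_{\mathbb N}$ and Painter colours it red or blue. The game ends when there is a red copy of $G$ or a blue copy of $H$ (as a not necessarily induced subgraph) on the board. Builder aims to finish the game as soon as possible, Painter aims to prolong it. The online size Ramsey number $\tilde r(G,H)$ is the number of rounds in $\tilde R(G,H)$ when both players play optimally, i.e. the least $t$ such that Builder has a strategy guaranteeing that the game ends within at most $t$ rounds whatever Painter does. -}

module Defs where

open import Data.Nat using (ℕ; suc; _≤_)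
open import Data.Nat.Properties using (1+n≢n)
open import Data.Fin using (Fin; toℕ)
open import Data.List using (List; []; _∷_)
open import Data.List.Membership.Propositional using (_∈_)
open import Data.Product using (Σ; _×_; _,_)
open import Data.Sum using (_⊎_; inj₁; inj₂; swap)
open import Function.Definitions using (Injective)
open import Relation.Binary.PropositionalEquality using (_≡_; _≢_)
open import Relation.Nullary using (¬_)

record Graph : Set₁ where
  field
    order     : ℕ
    Adj       : Fin order → Fin order → Set
    symmetric : ∀ {i j} → Adj i j → Adj j i
    loopless  : ∀ {i} → ¬ Adj i i

path : ℕ → Graph
path t = record
  { order     = t
  ; Adj       = λ i j → suc (toℕ i) ≡ toℕ j ⊎ suc (toℕ j) ≡ toℕ i
  ; symmetric = swap
  ; loopless  = λ { (inj₁ e) → 1+n≢n e ; (inj₂ e) → 1+n≢n e }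
  }

data Colour : Set where
  red blue : Colour

-- (u , v , c) records that the edge uv was selected and painted c.  The list
-- may contain either orientation of an edge; HasColour disregards it.
Board : Set
Board = List (ℕ × ℕ × Colour)

HasColour : Board → Colour → ℕ → ℕ → Set
HasColour b c u v = (u , v , c) ∈ b ⊎ (v , u , c) ∈ b

Unselected : Board → ℕ → ℕ → Set
Unselected b u v = ∀ c → ¬ HasColour b c u v

-- A not necessarily induced copy of G all of whose edges have colour c.
Copy : Graph → Board → Colour → Set
Copy G b c = Σ (Fin order → ℕ) λ f →
  Injective _≡_ _≡_ f × (∀ i j → Adj i j → HasColour b c (f i) (f j))
  where open Graph G

Ended : Graph → Graph → Board → Set
Ended G H b = Copy G b red ⊎ Copy H b blue

-- A Builder strategy, as a tree branching over Painter's answers, which from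
-- the position b makes the game end within at most t further rounds.
data Strategy (G H : Graph) : ℕ → Board → Set where
  stop   : ∀ {t b} → Ended G H b → Strategy G H t b
  select : ∀ {t b} (u v : ℕ) → u ≢ v → Unselected b u v →
           (∀ c → Strategy G H t ((u , v , c) ∷ b)) →
           Strategy G H (suc t) b

BuilderWinsWithin : Graph → Graph → ℕ → Set
BuilderWinsWithin G H t = Strategy G H t []

IsOnlineSizeRamseyNumber : Graph → Graph → ℕ → Set
IsOnlineSizeRamseyNumber G H r =
  BuilderWinsWithin G H r × (∀ t → BuilderWinsWithin G H t → r ≤ t)

{-# OPTIONS --safe #-}

-- Builder keeps one or two blue paths together with a few red edges at their
-- ends.  A red P₄-free graph forces many blue edges: an edge between vertices of
-- two nontrivial red components, or at a leaf of a red P₃, must be painted blue.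
-- There are seven recurring kinds of position ("hubs"), and from a hub h Builder
-- can add r edges to the blue paths, ending with a single path, within
-- ⌊(7r + offset h)/5⌋ rounds (a little more for some r ≤ 3): a red answer costs 5
-- units of potential and a blue one gains 2, and a finite tree of moves leads from
-- each hub to others without loss.  The trees are independent of r for r ≥ 9; the
-- bounds for large r follow from those for 9 ≤ r < 14 by the shift r + 5, T + 7.
-- The empty board has offset 6, which gives ⌊(7(n-1) + 6)/5⌋ = ⌈7n/5⌉ - 1.
--
-- A least number of rounds exists constructively because the game is decidable: up
-- to renaming the untouched vertices, Builder has only finitely many moves.
module Submission where

open import Defs
open import Data.Nat as ℕ using (ℕ; zero; suc; pred; _+_; _⊔_; _<_; _≥_; z≤n; s≤s; _<?_; _≤?_)
open import Data.Nat.Properties as ℕ using (_≟_; ≤-refl; ≤-trans; ≤-reflexive; <⇒≱; <-irrefl; ≰⇒>; n≤1+n; m≤n⇒m≤1+n; m≤m+n; m≤m⊔n; m≤n⊔m; +-suc; +-comm; +-assoc; +-identityʳ; +-cancelˡ-≡; +-monoʳ-≤; +-monoʳ-<; *-suc; *-distribˡ-+; anyUpTo?; allUpTo?)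
open import Data.Nat.DivMod using (+-distrib-/-∣ˡ; m/n*n≤m)
open import Data.Nat.Divisibility using (divides)
open import Data.Integer as ℤ using (+_; _≤_; _-_)
import Data.Integer.DivMod as ℤ
import Data.Integer.Properties as ℤ
open import Data.Rational.Unnormalised using (_/_; _*_; ceiling)
open import Data.Fin as Fin using (Fin; toℕ; inject≤)
import Data.Fin.Properties as Fin
open import Data.Vec as Vec using (Vec; []; _∷_)
open import Data.Vec.Properties using (lookup∘tabulate)
open import Data.Vec.Relation.Unary.All using ([]; _∷_) renaming (All to Allᵛ)
open import Data.Vec.Relation.Unary.All.Properties using () renaming (tabulate⁺ to Allᵛ-tabulate⁺)
open import Data.List using (List; []; _∷_; _++_; length; lookup; map; upTo)
open import Data.List.Properties using (++-identityʳ)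
open import Data.List.Membership.Propositional using (_∈_; _∉_; find)
open import Data.List.Membership.Propositional.Properties using (∈-lookup; ∈-upTo⁺)
open import Data.List.Membership.DecPropositional _≟_ using (_∈?_)
open import Data.List.Relation.Unary.All as All using (All; []; _∷_)
import Data.List.Relation.Unary.All.Properties as All
open import Data.List.Relation.Unary.AllPairs using ([]; _∷_)
open import Data.List.Relation.Unary.Any using (Any; here; there; any?)
open import Data.List.Relation.Unary.Linked using (Linked; []; [-]; _∷_)
open import Data.List.Relation.Unary.Unique.Propositional using (Unique)
import Data.List.Relation.Unary.Unique.Propositional.Properties as Unique
open import Data.List.Relation.Unary.Unique.DecPropositional _≟_ using (unique?)
open import Data.List.Relation.Binary.Permutation.Propositional using (_↭_; ↭-refl; ↭-sym; ↭-trans; ↭-prep; ↭⇒↭ₛ)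
open import Data.List.Relation.Binary.Permutation.Propositional.Properties using (++⁺ˡ; ++⁺ʳ; ++-comm; ++-assoc; shifts; ↭-length; ∈-resp-↭)
import Data.List.Relation.Binary.Permutation.Setoid.Properties as ↭ₛ
open import Data.Maybe as Maybe using (Maybe; just; nothing; _>>=_)
open import Data.Maybe.Relation.Unary.All as AllM using (just; nothing)
import Data.Maybe.Relation.Unary.Any as AnyM
open import Data.Product as Prod using (∃; ∃-syntax; _×_; _,_; proj₁; proj₂)
open import Data.Product.Properties using (≡-dec)
open import Data.Sum as Sum using (_⊎_; inj₁; inj₂)
open import Data.Empty using (⊥)
open import Data.Unit using (⊤; tt)
open import Function using (_∘_; _$_; id)
open import Function.Definitions using (Injective)
open import Relation.Binary using (Decidable; DecidableEquality)
open import Relation.Binary.PropositionalEquality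
open import Relation.Nullary using (Dec; yes; no; contradiction)
open import Relation.Nullary.Decidable using (map′; _×-dec_; _⊎-dec_; _→-dec_; ¬?; from-yes)

-- Boards, embeddings and transport of strategies

_≟ᶜ_ : DecidableEquality Colour
red ≟ᶜ red = yes refl
red ≟ᶜ blue = no λ ()
blue ≟ᶜ red = no λ ()
blue ≟ᶜ blue = yes refl

open import Data.List.Membership.DecPropositional (≡-dec _≟_ (≡-dec _≟_ _≟ᶜ_)) using () renaming (_∈?_ to _∈ᵇ?_)

HasColour? : ∀ b c u v → Dec (HasColour b c u v)
HasColour? b c u v = ((u , v , c) ∈ᵇ? b) ⊎-dec ((v , u , c) ∈ᵇ? b)

HasColour-there : ∀ {b e c u v} → HasColour b c u v → HasColour (e ∷ b) c u v
HasColour-there = Sum.map there there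

HasColour-sym : ∀ {b c u v} → HasColour b c u v → HasColour b c v u
HasColour-sym = Sum.swap

-- `forth` transports copies; `back` keeps unselected edges unselected, so that whole strategies can
-- be transported too.
record Embeds (π : ℕ → ℕ) (b b′ : Board) : Set where
  field
    injective : Injective _≡_ _≡_ π
    forth     : ∀ {c u v} → HasColour b c u v → HasColour b′ c (π u) (π v)
    back      : ∀ {c u v} → HasColour b′ c (π u) (π v) → HasColour b c u v

Embeds-∷ : ∀ {π b b′} u v c → Embeds π b b′ →
           Embeds π ((u , v , c) ∷ b) ((π u , π v , c) ∷ b′)
Embeds-∷ {π} {b} {b′} u v c em = record
  { injective = injective
  ; forth     = λ { (inj₁ (here refl)) → inj₁ (here refl)
                  ; (inj₂ (here refl)) → inj₂ (here refl)
                  ; (inj₁ (there p))   → HasColour-there (forth (inj₁ p))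
                  ; (inj₂ (there p))   → HasColour-there (forth (inj₂ p)) }
  ; back      = λ { (inj₁ (here e))  → inj₁ (here (unmap e))
                  ; (inj₂ (here e))  → inj₂ (here (unmap e))
                  ; (inj₁ (there p)) → HasColour-there (back (inj₁ p))
                  ; (inj₂ (there p)) → HasColour-there (back (inj₂ p)) }
  }
  where
  open Embeds em
  unmap : ∀ {x y c′} → (π x , π y , c′) ≡ (π u , π v , c) → (x , y , c′) ≡ (u , v , c)
  unmap e = cong₂ _,_ (injective (cong proj₁ e))
    (cong₂ _,_ (injective (cong (proj₁ ∘ proj₂) e)) (cong (proj₂ ∘ proj₂) e))

Copy-embeds : ∀ G {π b b′ c} → Embeds π b b′ → Copy G b c → Copy G b′ c
Copy-embeds G {π} em (f , f-injective , adj) =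
  π ∘ f , f-injective ∘ injective , λ i j a → forth (adj i j a)
  where open Embeds em

module _ {G H : Graph} where

  Strategy-mono : ∀ {s t b} → s ℕ.≤ t → Strategy G H s b → Strategy G H t b
  Strategy-mono _         (stop e)                 = stop e
  Strategy-mono (s≤s s≤t) (select u v u≢v new k) =
    select u v u≢v new (λ c → Strategy-mono s≤t (k c))

  Strategy-embeds : ∀ {π t b b′} → Embeds π b b′ → Strategy G H t b → Strategy G H t b′
  Strategy-embeds em (stop e) = stop (Sum.map (Copy-embeds G em) (Copy-embeds H em) e)
  Strategy-embeds {π} em (select u v u≢v new k) =
    select (π u) (π v) (u≢v ∘ injective) (λ c → new c ∘ back)
           (λ c → Strategy-embeds (Embeds-∷ u v c em) (k c))
    where open Embeds em

  -- Recording an edge twice does not change `HasColour`, so the identity embeds the longer list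
  -- into the shorter one.
  Strategy-reselect : ∀ {t b} u v c → HasColour b c u v →
                      Strategy G H t ((u , v , c) ∷ b) → Strategy G H t b
  Strategy-reselect {b = b} u v c old = Strategy-embeds record
    { injective = id
    ; forth     = λ { (inj₁ (here refl)) → old
                    ; (inj₂ (here refl)) → HasColour-sym {b} old
                    ; (inj₁ (there p))   → inj₁ p
                    ; (inj₂ (there p))   → inj₂ p }
    ; back      = HasColour-there
    }

  -- A selected edge may be proposed again: Builder then follows the branch of
  -- the colour it already has.
  propose : ∀ {t b} u v → u ≢ v → (∀ c → Strategy G H t ((u , v , c) ∷ b)) →
            Strategy G H (suc t) b
  propose {b = b} u v u≢v k with HasColour? b red u v | HasColour? b blue u v
  ... | yes old | _       = Strategy-mono (n≤1+n _) (Strategy-reselect u v red old (k red))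
  ... | no _    | yes old = Strategy-mono (n≤1+n _) (Strategy-reselect u v blue old (k blue))
  ... | no new  | no new′ = select u v u≢v (λ { red → new ; blue → new′ }) k

-- Decidability of the game

limit : Board → ℕ
limit []                = 0
limit ((u , v , _) ∷ b) = suc u ⊔ suc v ⊔ limit b

∈⇒<limit : ∀ {b u v c} → (u , v , c) ∈ b → u < limit b × v < limit b
∈⇒<limit {(u , v , _) ∷ b} (here refl) =
  ≤-trans (m≤m⊔n (suc u) (suc v)) (m≤m⊔n _ (limit b)) ,
  ≤-trans (m≤n⊔m (suc u) (suc v)) (m≤m⊔n _ (limit b))
∈⇒<limit {(u , v , _) ∷ b} (there p) with ∈⇒<limit p
... | u< , v< = ≤-trans u< (m≤n⊔m (suc u ⊔ suc v) _) , ≤-trans v< (m≤n⊔m (suc u ⊔ suc v) _)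

HasColour⇒<limit : ∀ {b c u v} → HasColour b c u v → u < limit b × v < limit b
HasColour⇒<limit (inj₁ p) = ∈⇒<limit p
HasColour⇒<limit (inj₂ p) = Prod.swap (∈⇒<limit p)

search? : ∀ k N {P : Vec ℕ k → Set} → (∀ xs → Dec (P xs)) →
          Dec (∃ λ xs → Allᵛ (_< N) xs × P xs)
search? zero    N P? = map′ (λ p → [] , [] , p) (λ { ([] , _ , p) → p }) (P? [])
search? (suc k) N P? = map′
  (λ { (x , x< , xs , xs< , p) → x ∷ xs , x< ∷ xs< , p })
  (λ { (x ∷ xs , x< ∷ xs< , p) → x , x< , xs , xs< , p })
  (anyUpTo? (λ x → search? k N (λ xs → P? (x ∷ xs))) N)

-- `noIsolated` puts every vertex of a copy on a selected edge, hence below `limit b`; this makes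
-- the search for copies finite.
record Searchable (G : Graph) : Set where
  open Graph G
  field
    Adj?       : Decidable Adj
    noIsolated : ∀ i → ∃ (Adj i)

path-searchable : ∀ n → Searchable (path (2 + n))
path-searchable n = record
  { Adj?       = λ i j → (suc (toℕ i) ≟ toℕ j) ⊎-dec (suc (toℕ j) ≟ toℕ i)
  ; noIsolated = λ { Fin.zero → Fin.suc Fin.zero , inj₁ refl
                   ; (Fin.suc i) → Fin.inject₁ i , inj₂ (cong suc (Fin.toℕ-inject₁ i)) }
  }

copy? : ∀ {G} → Searchable G → ∀ b c → Dec (Copy G b c)
copy? {G} sr b c = map′
  (λ { (xs , _ , p) → Vec.lookup xs , p })
  (λ { (f , inj , adj) → Vec.tabulate f ,
       Allᵛ-tabulate⁺ (λ i → proj₁ (HasColour⇒<limit (adj i _ (proj₂ (noIsolated i))))) ,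
       (λ {i} {j} e → inj (trans (sym (lookup∘tabulate f i)) (trans e (lookup∘tabulate f j)))) ,
       λ i j a → subst₂ (HasColour b c) (sym (lookup∘tabulate f i)) (sym (lookup∘tabulate f j)) (adj i j a) })
  (search? order (limit b) λ xs →
    map′ (λ h {i} {j} → h i j) (λ h i j → h)
      (Fin.all? λ i → Fin.all? λ j → (Vec.lookup xs i ≟ Vec.lookup xs j) →-dec (i Fin.≟ j))
    ×-dec
    Fin.all? λ i → Fin.all? λ j →
      Adj? i j →-dec HasColour? b c (Vec.lookup xs i) (Vec.lookup xs j))
  where
  open Graph G
  open Searchable sr

transpose : ℕ → ℕ → ℕ → ℕ
transpose i j x with x ≟ i | x ≟ j
... | yes _ | _     = j
... | no _  | yes _ = i
... | no _  | no _  = x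

transpose-involutive : ∀ i j x → transpose i j (transpose i j x) ≡ x
transpose-involutive i j x with x ≟ i | x ≟ j
transpose-involutive i j x | yes x≡i | _ with j ≟ i | j ≟ j
... | yes j≡i | _      = trans j≡i (sym x≡i)
... | no _    | yes _  = sym x≡i
... | no _    | no j≢j = contradiction refl j≢j
transpose-involutive i j x | no _ | yes x≡j with i ≟ i | i ≟ j
... | yes _  | _ = sym x≡j
... | no i≢i | _ = contradiction refl i≢i
transpose-involutive i j x | no x≢i | no x≢j with x ≟ i | x ≟ j
... | yes x≡i | _       = contradiction x≡i x≢i
... | no _    | yes x≡j = contradiction x≡j x≢j
... | no _    | no _    = refl

transpose-injective : ∀ i j → Injective _≡_ _≡_ (transpose i j)
transpose-injective i j {x} {y} e = trans (sym (transpose-involutive i j x))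
  (trans (cong (transpose i j) e) (transpose-involutive i j y))

transpose-left : ∀ i j → transpose i j i ≡ j
transpose-left i j with i ≟ i
... | yes _  = refl
... | no i≢i = contradiction refl i≢i

transpose-fixes : ∀ {i j x} → x ≢ i → x ≢ j → transpose i j x ≡ x
transpose-fixes {i} {j} {x} x≢i x≢j with x ≟ i | x ≟ j
... | yes x≡i | _       = contradiction x≡i x≢i
... | no _    | yes x≡j = contradiction x≡j x≢j
... | no _    | no _    = refl

-- If w is not below k, swapping it with k moves nothing below k.
lower : ∀ k w → ∃ λ π → Injective _≡_ _≡_ π × (∀ {x} → x < k → π x ≡ x) × π w < suc k
lower k w with w <? k
... | yes w<k = id , id , (λ _ → refl) , m≤n⇒m≤1+n w<k
... | no  w≮k = transpose w k , transpose-injective w k ,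
  (λ x<k → transpose-fixes (λ { refl → w≮k x<k }) (λ { refl → <-irrefl refl x<k })) ,
  subst (_< suc k) (sym (transpose-left w k)) ≤-refl

fixing-embeds : ∀ {π b} → Injective _≡_ _≡_ π → (∀ {x} → x < limit b → π x ≡ x) → Embeds π b b
fixing-embeds {π} {b} inj fix = record
  { injective = inj
  ; forth     = λ {c} p → let u< , v< = HasColour⇒<limit p in
                  subst₂ (HasColour b c) (sym (fix u<)) (sym (fix v<)) p
  ; back      = λ {c} p → let u< , v< = HasColour⇒<limit p in
                  subst₂ (HasColour b c) (inj (fix u<)) (inj (fix v<)) p
  }

module _ {G H : Graph} (G-searchable : Searchable G) (H-searchable : Searchable H) where

  ended? : ∀ b → Dec (Ended G H b)
  ended? b = copy? G-searchable b red ⊎-dec copy? H-searchable b blue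

  strategy? : ∀ t b → Dec (Strategy G H t b)
  strategy? zero    b = map′ stop (λ { (stop e) → e }) (ended? b)
  strategy? (suc t) b = map′ to from
    (ended? b ⊎-dec
     anyUpTo? (λ u → anyUpTo? (λ v → ¬? (u ≟ v) ×-dec
       strategy? t ((u , v , red) ∷ b) ×-dec strategy? t ((u , v , blue) ∷ b)) N) N)
    where
    -- A move touches at most two new vertices, which may be taken to be `limit b` and
    -- `suc (limit b)`.
    N = 2 + limit b
    Move = ∃ λ u → u < N × ∃ λ v → v < N × u ≢ v ×
      Strategy G H t ((u , v , red) ∷ b) × Strategy G H t ((u , v , blue) ∷ b)
    to : Ended G H b ⊎ Move → Strategy G H (suc t) b
    to (inj₁ e) = stop e
    to (inj₂ (u , _ , v , _ , u≢v , r , s)) = propose u v u≢v λ { red → r ; blue → s }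
    from : Strategy G H (suc t) b → Ended G H b ⊎ Move
    from (stop e) = inj₁ e
    from (select u v u≢v new k)
      -- `π₁` brings u to at most `limit b`; `π₂` then brings v below `N` without moving the image
      -- of u.
      with π₁ , π₁-injective , fix₁ , u< ← lower (limit b) u
      with π₂ , π₂-injective , fix₂ , v< ← lower (suc (limit b)) (π₁ v) =
        inj₂ (π₂ (π₁ u) , subst (_< N) (sym (fix₂ u<)) (m≤n⇒m≤1+n u<) ,
              π₂ (π₁ v) , v< , u≢v ∘ π₁-injective ∘ π₂-injective , next red , next blue)
      where
      em : Embeds (π₂ ∘ π₁) b b
      em = fixing-embeds (π₁-injective ∘ π₂-injective)
        (λ x< → trans (cong π₂ (fix₁ x<)) (fix₂ (m≤n⇒m≤1+n x<)))
      next : ∀ c → Strategy G H t ((π₂ (π₁ u) , π₂ (π₁ v) , c) ∷ b)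
      next c = Strategy-embeds (Embeds-∷ u v c em) (k c)

  least : ∀ t → BuilderWinsWithin G H t → ∃[ r ] IsOnlineSizeRamseyNumber G H r × r ℕ.≤ t
  least zero    w = 0 , (w , λ _ _ → z≤n) , z≤n
  least (suc t) w with strategy? t []
  ... | yes w′ = let r , num , r≤t = least t w′ in r , num , m≤n⇒m≤1+n r≤t
  ... | no ¬w′ = suc t , (w , λ s ws → ≰⇒> λ s≤t → ¬w′ (Strategy-mono s≤t ws)) , ≤-refl

-- Positions

lookup-injective : ∀ {A : Set} {xs : List A} → Unique xs → Injective _≡_ _≡_ (lookup xs)
lookup-injective {xs = _ ∷ _} _          {Fin.zero}  {Fin.zero}  _ = refl
lookup-injective {xs = _ ∷ _} (x∉ ∷ _)   {Fin.zero}  {Fin.suc j} e = contradiction e (All.lookup x∉ (∈-lookup j))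
lookup-injective {xs = _ ∷ _} (x∉ ∷ _)   {Fin.suc i} {Fin.zero}  e = contradiction (sym e) (All.lookup x∉ (∈-lookup i))
lookup-injective {xs = _ ∷ _} (_ ∷ xs!)  {Fin.suc i} {Fin.suc j} e = cong Fin.suc (lookup-injective xs! e)

lookup-linked : ∀ {A : Set} {R : A → A → Set} {xs} → Linked R xs →
                ∀ i j → suc (toℕ i) ≡ toℕ j → R (lookup xs i) (lookup xs j)
lookup-linked [-]      Fin.zero    (Fin.suc ()) _
lookup-linked (r ∷ _)  Fin.zero    (Fin.suc Fin.zero) refl = r
lookup-linked (_ ∷ rs) (Fin.suc i) (Fin.suc j) e = lookup-linked rs i j (cong pred e)

path-copy : ∀ {b c} n vs → n ℕ.≤ length vs → Unique vs → Linked (HasColour b c) vs →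
            Copy (path n) b c
path-copy {b} {c} n vs n≤ vs! linked =
  lookup vs ∘ at , Fin.inject≤-injective n≤ n≤ _ _ ∘ lookup-injective vs! ,
  λ { i j (inj₁ e) → step i j e ; i j (inj₂ e) → HasColour-sym {b} (step j i e) }
  where
  at : Fin n → Fin (length vs)
  at i = inject≤ i n≤
  step : ∀ i j → suc (toℕ i) ≡ toℕ j → HasColour b c (lookup vs (at i)) (lookup vs (at j))
  step i j e = lookup-linked linked (at i) (at j)
    (trans (cong suc (Fin.toℕ-inject≤ i n≤)) (trans e (sym (Fin.toℕ-inject≤ j n≤))))

-- Blue paths

data Line (b : Board) : ℕ → ℕ → List ℕ → Set where
  [_] : ∀ x → Line b x x (x ∷ [])
  _∷_ : ∀ {x y z vs} → HasColour b blue x y → Line b y z vs → Line b x z (x ∷ vs)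

Line-++ : ∀ {b x y z w us vs} → Line b x y us → HasColour b blue y z → Line b z w vs →
          Line b x w (us ++ vs)
Line-++ [ x ]   f l = f ∷ l
Line-++ (e ∷ k) f l = e ∷ Line-++ k f l

Line-reverse : ∀ {b x y vs} → Line b x y vs → ∃ λ vs′ → vs′ ↭ vs × Line b y x vs′
Line-reverse [ x ] = _ , ↭-refl , [ x ]
Line-reverse {b} {x} (e ∷ l) with vs′ , σ , l′ ← Line-reverse l =
  vs′ ++ x ∷ [] , ↭-trans (++-comm vs′ (x ∷ [])) (↭-prep x σ) ,
  Line-++ l′ (HasColour-sym {b} e) [ x ]

Line-linked : ∀ {b x y vs} → Line b x y vs → Linked (HasColour b blue) vs
Line-linked [ x ]         = [-]
Line-linked (e ∷ [ x ])   = e ∷ [-]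
Line-linked (e ∷ f ∷ l) = e ∷ Line-linked (f ∷ l)

Line-there : ∀ {b e x y vs} → Line b x y vs → Line (e ∷ b) x y vs
Line-there [ x ]   = [ x ]
Line-there (e ∷ l) = HasColour-there e ∷ Line-there l

data Lines (b : Board) (ρ : ℕ → ℕ) : List (ℕ × ℕ) → List ℕ → Set where
  []  : Lines b ρ [] []
  _∷_ : ∀ {x y es us vs} → Line b (ρ x) (ρ y) us → Lines b ρ es vs →
        Lines b ρ ((x , y) ∷ es) (us ++ vs)

-- Reversing or reordering paths permutes the concatenated vertex list, so that list is kept only up
-- to permutation.
Lines↭ : Board → (ℕ → ℕ) → List (ℕ × ℕ) → List ℕ → Set
Lines↭ b ρ es vs = ∃ λ vs′ → vs′ ↭ vs × Lines b ρ es vs′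

Lines-there : ∀ {b e ρ es vs} → Lines b ρ es vs → Lines (e ∷ b) ρ es vs
Lines-there []       = []
Lines-there (l ∷ ls) = Line-there l ∷ Lines-there ls

detach : ℕ → List (ℕ × ℕ) → Maybe (ℕ × List (ℕ × ℕ))
detach u []             = nothing
detach u ((x , y) ∷ es) with u ≟ x | u ≟ y
... | yes _ | _     = just (y , es)
... | no _  | yes _ = just (x , es)
... | no _  | no _  = Maybe.map (Prod.map₂ ((x , y) ∷_)) (detach u es)

Detached : Board → (ℕ → ℕ) → ℕ → List (ℕ × ℕ) → List ℕ → ℕ × List (ℕ × ℕ) → Set
Detached b ρ u es vs (w , es′) =
  length es ≡ suc (length es′) × Lines↭ b ρ ((w , u) ∷ es′) vs

detach-sound : ∀ {b ρ} u {es vs} → Lines b ρ es vs →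
               AllM.All (Detached b ρ u es vs) (detach u es)
detach-sound u [] = nothing
detach-sound u (_∷_ {x} {y} {es} {us} {vs} l ls) with u ≟ x | u ≟ y
... | yes refl | _ with us′ , σ , l′ ← Line-reverse l =
  just (refl , _ , ++⁺ʳ vs σ , l′ ∷ ls)
... | no _ | yes refl = just (refl , _ , ↭-refl , l ∷ ls)
... | no _ | no _ with detach u es | detach-sound u ls
...   | nothing | _ = nothing
...   | just _  | just (len , _ , σ , _∷_ {us = us₁} k ks) =
  just (cong suc len , _ , ↭-trans (shifts us₁ us) (++⁺ˡ us σ) , k ∷ l ∷ ks)

-- Vertices are given abstract names.  A pair in ends names the two ends of a
-- blue path, a pair in reds names a red edge; only the names outside used are
-- known to lie on none of the paths.
record Position : Set where
  constructor position
  field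
    ends : List (ℕ × ℕ)
    used : List ℕ
    reds : List (ℕ × ℕ)

open Position

-- ρ interprets the names on the board; enough says that the paths together lack
-- at most r of the m edges wanted.
record Holds (m r : ℕ) (p : Position) (ρ : ℕ → ℕ) (b : Board) : Set where
  field
    injective : Injective _≡_ _≡_ ρ
    vertices  : List ℕ
    lines     : Lines b ρ (ends p) vertices
    distinct  : Unique vertices
    unused    : ∀ {n} → n ∉ used p → ρ n ∉ vertices
    redEdges  : ∀ {u v} → (u , v) ∈ reds p → HasColour b red (ρ u) (ρ v)
    enough    : m + length (ends p) ℕ.≤ r + length vertices

-- Recording Painter's answers in a position

Unique-resp-↭ : ∀ {xs ys : List ℕ} → xs ↭ ys → Unique xs → Unique ys
Unique-resp-↭ σ = ↭ₛ.Unique-resp-↭ (setoid ℕ) (↭⇒↭ₛ σ)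

-- The result is the other end of the path ending at u, with the position deprived of that path. A
-- name outside `used` counts as a new path of one vertex; a used name that ends no path may be
-- interior, so it cannot be grabbed.
grab : ℕ → Position → Maybe (ℕ × Position)
grab u (position es us rs) with detach u es | u ∈? us
... | just (w , es′) | _     = just (w , position es′ us rs)
... | nothing        | no _  = just (u , position es (u ∷ us) rs)
... | nothing        | yes _ = nothing

attach : ℕ × ℕ → Position → Position
attach e (position es us rs) = position (e ∷ es) us rs

redden : ℕ → ℕ → Position → Position
redden u v (position es us rs) = position es us ((u , v) ∷ rs)

grab-sound : ∀ {m r ρ b} u {p} → Holds m r p ρ b →
             AllM.All (λ (w , q) → Holds m r (attach (w , u) q) ρ b) (grab u p)
grab-sound {m} {r} {ρ} u {position es us rs} h
  with detach u es | detach-sound u (Holds.lines h) | u ∈? us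
... | just _ | just (len , vs , σ , ls) | _ = just record
  { injective = injective ; lines = ls ; distinct = Unique-resp-↭ (↭-sym σ) distinct
  ; unused = λ n∉ → unused n∉ ∘ ∈-resp-↭ σ ; redEdges = redEdges
  ; enough = subst₂ (λ k l → m + k ℕ.≤ r + l) len (sym (↭-length σ)) enough }
  where open Holds h
... | nothing | _ | no u∉ = just record
  { injective = injective ; lines = [ ρ u ] ∷ lines
  ; distinct = All.tabulate (λ { x∈ refl → unused u∉ x∈ }) ∷ distinct
  ; unused = λ { n∉ (here e) → n∉ (here (injective e)) ; n∉ (there x∈) → unused (n∉ ∘ there) x∈ }
  ; redEdges = redEdges
  -- A one-vertex path adds one vertex and one path, hence no edge, so r is unchanged.
  ; enough = subst₂ ℕ._≤_ (sym (+-suc m _)) (sym (+-suc r _)) (s≤s enough) }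
  where open Holds h
... | nothing | _ | yes _ = nothing

-- `join` calls this after taking off the path from x to v. The first remaining path then ends in u,
-- unless u and v were the two ends of one path; there the test fails, as a blue edge would close a
-- cycle.
fuse : ℕ → ℕ → Position → Maybe Position
fuse u x (position []             us rs) = nothing
fuse u x (position ((w , y) ∷ es) us rs) with y ≟ u
... | yes _ = just (position ((x , w) ∷ es) us rs)
... | no _  = nothing

fuse-sound : ∀ {m r ρ b} u v x q → HasColour b blue (ρ v) (ρ u) →
             Holds m r (attach (x , v) q) ρ b →
             AllM.All (λ p → Holds m (pred r) p ρ b) (fuse u x q)
fuse-sound u v x (position []             us rs) _ _ = nothing
fuse-sound {m} {r} u v x (position ((w , y) ∷ es) us rs) vu h with y ≟ u
... | no _     = nothing
... | yes refl = just (merge h)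
  where
  merge : Holds m r (position ((x , v) ∷ (w , y) ∷ es) us rs) _ _ →
          Holds m (pred r) (position ((x , w) ∷ es) us rs) _ _
  merge record { injective = injective ; lines = _∷_ {us = ks} k (_∷_ {us = ls} {vs = vs} l rest)
               ; distinct = distinct ; unused = unused ; redEdges = redEdges ; enough = enough }
    with ls′ , σ , l′ ← Line-reverse l = record
    { injective = injective
    ; lines = Line-++ k vu l′ ∷ rest
    ; distinct = Unique-resp-↭ (↭-sym τ) distinct
    ; unused = λ n∉ → unused n∉ ∘ ∈-resp-↭ τ
    ; redEdges = redEdges
    ; enough = spend r (subst₂ (λ i j → i ℕ.≤ r + j) (+-suc m _) (sym (↭-length τ)) enough)
    }
    where
    τ : (ks ++ ls′) ++ vs ↭ ks ++ ls ++ vs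
    τ = ↭-trans (++-assoc ks ls′ vs) (++⁺ˡ ks (++⁺ʳ vs σ))
    -- At r = 0 the budget stays 0 and the new blue edge is mere surplus.
    spend : ∀ r {i j} → suc i ℕ.≤ r + j → i ℕ.≤ pred r + j
    spend zero    le = ≤-trans (n≤1+n _) le
    spend (suc r) le = ℕ.s≤s⁻¹ le

>>=-All : ∀ {A B : Set} {P : A → Set} {Q : B → Set} {f : A → Maybe B} {mx} →
          AllM.All P mx → (∀ {x} → P x → AllM.All Q (f x)) → AllM.All Q (mx >>= f)
>>=-All nothing  k = nothing
>>=-All (just p) k = k p

join : ℕ → ℕ → Position → Maybe Position
join u v p = grab u p >>= λ (w , q) → grab v (attach (w , u) q) >>= λ (x , q′) → fuse u x q′

Holds-there : ∀ {m r p ρ b e} → Holds m r p ρ b → Holds m r p ρ (e ∷ b)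
Holds-there h = record
  { injective = injective ; lines = Lines-there lines ; distinct = distinct ; unused = unused
  ; redEdges = HasColour-there ∘ redEdges ; enough = enough }
  where open Holds h

join-sound : ∀ {m r ρ b} u v {p} → HasColour b blue (ρ v) (ρ u) → Holds m r p ρ b →
             AllM.All (λ q → Holds m (pred r) q ρ b) (join u v p)
join-sound u v vu h = >>=-All (grab-sound u h) λ h₁ → >>=-All (grab-sound v h₁) λ {(x , q)} → fuse-sound u v x q vu

redden-sound : ∀ {m r ρ b} u v {p} → HasColour b red (ρ u) (ρ v) → Holds m r p ρ b →
               Holds m r (redden u v p) ρ b
redden-sound u v uv h = record
  { injective = injective ; lines = lines ; distinct = distinct ; unused = unused
  ; redEdges = λ { (here refl) → uv ; (there e∈) → redEdges e∈ } ; enough = enough }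
  where open Holds h

Joined : List (ℕ × ℕ) → ℕ → ℕ → Set
Joined rs u v = (u , v) ∈ rs ⊎ (v , u) ∈ rs

open import Data.List.Membership.DecPropositional (≡-dec _≟_ _≟_) using () renaming (_∈?_ to _∈ₑ?_)

Joined? : ∀ rs u v → Dec (Joined rs u v)
Joined? rs u v = ((u , v) ∈ₑ? rs) ⊎-dec ((v , u) ∈ₑ? rs)

Joined-sound : ∀ {m r p ρ b u v} → Holds m r p ρ b → Joined (reds p) u v → HasColour b red (ρ u) (ρ v)
Joined-sound {b = b} h = Sum.[ redEdges , HasColour-sym {b} ∘ redEdges ]
  where open Holds h

-- Red paths on four vertices

arcs : List (ℕ × ℕ) → List (ℕ × ℕ)
arcs rs = rs ++ map Prod.swap rs

RedP₄ : List (ℕ × ℕ) → Set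
RedP₄ rs = Any (λ (w , x) → Any (λ (x′ , y) → x′ ≡ x × Any (λ (y′ , z) → y′ ≡ y ×
  Unique (w ∷ x ∷ y ∷ z ∷ [])) (arcs rs)) (arcs rs)) (arcs rs)

RedP₄? : ∀ rs → Dec (RedP₄ rs)
RedP₄? rs = any? (λ (w , x) → any? (λ (x′ , y) → (x′ ≟ x) ×-dec any? (λ (y′ , z) → (y′ ≟ y) ×-dec
  unique? (w ∷ x ∷ y ∷ z ∷ [])) (arcs rs)) (arcs rs)) (arcs rs)

arcs-red : ∀ {m r p ρ b} → Holds m r p ρ b →
           All (λ (u , v) → HasColour b red (ρ u) (ρ v)) (arcs (reds p))
arcs-red {b = b} h = All.++⁺ (All.tabulate redEdges)
  (All.map⁺ (All.tabulate (HasColour-sym {b} ∘ redEdges)))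
  where open Holds h

RedP₄-sound : ∀ {m r p ρ b} → Holds m r p ρ b → RedP₄ (reds p) → Copy (path 4) b red
RedP₄-sound h p₄
  with (w , x) , wx , i ← find p₄
  with (_ , y) , xy , refl , j ← find i
  with (_ , z) , yz , refl , wxyz! ← find j =
  path-copy 4 _ ≤-refl (Unique.map⁺ (Holds.injective h) wxyz!)
    (All.lookup (arcs-red h) wx ∷ All.lookup (arcs-red h) xy ∷ All.lookup (arcs-red h) yz ∷ [-])

-- 20 exceeds all names mentioned in the strategy, so that the names beyond the
-- list xs stay unused.
rename : List ℕ → ℕ → ℕ
rename []       n       = 20 + n
rename (x ∷ xs) zero    = x
rename (x ∷ xs) (suc n) = rename xs n

rename-range : ∀ xs n → (n < length xs × rename xs n ∈ xs) ⊎ (length xs ℕ.≤ n × 20 ℕ.≤ rename xs n)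
rename-range []       n       = inj₂ (z≤n , m≤m+n 20 n)
rename-range (x ∷ xs) zero    = inj₁ (s≤s z≤n , here refl)
rename-range (x ∷ xs) (suc n) = Sum.map (Prod.map s≤s there) (Prod.map₁ s≤s) (rename-range xs n)

rename-≢head : ∀ {x xs} → All (_< 20) (x ∷ xs) → Unique (x ∷ xs) → ∀ n → x ≢ rename xs n
rename-≢head {x} {xs} (x< ∷ _) (x∉ ∷ _) n refl with rename-range xs n
... | inj₁ (_ , x∈) = All.lookup x∉ x∈ refl
... | inj₂ (_ , 20≤) = <⇒≱ x< 20≤

rename-injective : ∀ {xs} → All (_< 20) xs → Unique xs → Injective _≡_ _≡_ (rename xs)
rename-injective []         []          e = +-cancelˡ-≡ 20 _ _ e
rename-injective (x< ∷ xs<) (x∉ ∷ xs!) {zero}  {zero}  e = refl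
rename-injective (x< ∷ xs<) (x∉ ∷ xs!) {zero}  {suc j} e = contradiction e (rename-≢head (x< ∷ xs<) (x∉ ∷ xs!) j)
rename-injective (x< ∷ xs<) (x∉ ∷ xs!) {suc i} {zero}  e = contradiction (sym e) (rename-≢head (x< ∷ xs<) (x∉ ∷ xs!) i)
rename-injective (x< ∷ xs<) (x∉ ∷ xs!) {suc i} {suc j} e = cong suc (rename-injective xs< xs! e)

-- Recognising a hub inside a position

Matches : (ℕ → ℕ) → List (ℕ × ℕ) → List (ℕ × ℕ) → Set
Matches π []             []      = ⊤
Matches π []             (_ ∷ _) = ⊥
Matches π ((x , y) ∷ hs) es      =
  AnyM.Any (λ (w , es′) → w ≡ π x × Matches π hs es′) (detach (π y) es)

Matches? : ∀ π hs es → Dec (Matches π hs es)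
Matches? π []             []      = yes tt
Matches? π []             (_ ∷ _) = no λ ()
Matches? π ((x , y) ∷ hs) es      =
  AnyM.dec (λ (w , es′) → (w ≟ π x) ×-dec Matches? π hs es′) (detach (π y) es)

meet : ∀ {A : Set} {P Q : A → Set} {mx} → AllM.All P mx → AnyM.Any Q mx → ∃ λ x → P x × Q x
meet (just p) (AnyM.just q) = _ , p , q

Matches-sound : ∀ {b ρ π} hs {es vs} → Matches π hs es → Lines b ρ es vs →
                length es ≡ length hs × Lines↭ b (ρ ∘ π) hs vs
Matches-sound []             {[]} _ [] = refl , _ , ↭-refl , []
Matches-sound {π = π} ((x , y) ∷ hs) match ls
  with _ , (len , _ , σ , _∷_ {us = us} k ks) , refl , match′ ← meet (detach-sound (π y) ls) match
  with len′ , _ , τ , hls ← Matches-sound hs match′ ks =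
  trans len (cong suc len′) , _ , ↭-trans (++⁺ˡ us τ) σ , k ∷ hls

record Fits (π : List ℕ) (q p : Position) : Set where
  constructor fits
  field
    small    : All (_< 20) π
    unique   : Unique π
    bounded  : All (_< 20) (used p)
    matches  : Matches (rename π) (ends q) (ends p)
    joined   : All (λ (u , v) → Joined (reds p) (rename π u) (rename π v)) (reds q)
    -- Names past the end of π go to 20 and beyond, outside `used p` by `bounded`, so finitely many
    -- checks suffice.
    apart    : All (λ n → n ∈ used q ⊎ rename π n ∉ used p) (upTo (length π))

Fits? : ∀ π q p → Dec (Fits π q p)
Fits? π q p = map′ (λ (a , b , c , d , e , f) → fits a b c d e f)
  (λ (fits a b c d e f) → a , b , c , d , e , f)
  (All.all? (_<? 20) π ×-dec unique? π ×-dec All.all? (_<? 20) (used p) ×-dec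
   Matches? (rename π) (ends q) (ends p) ×-dec
   All.all? (λ (u , v) → Joined? (reds p) (rename π u) (rename π v)) (reds q) ×-dec
   All.all? (λ n → (n ∈? used q) ⊎-dec ¬? (rename π n ∈? used p)) (upTo (length π)))

Fits-sound : ∀ {m r ρ b} π q p → Fits π q p → Holds m r p ρ b → Holds m r q (ρ ∘ rename π) b
Fits-sound {m} {r} {ρ} π q p (fits small unique bounded matches joined apart) h
  with len , vs , σ , ls ← Matches-sound (ends q) matches (Holds.lines h) = record
  { injective = rename-injective small unique ∘ injective
  ; lines = ls
  ; distinct = Unique-resp-↭ (↭-sym σ) distinct
  ; unused = λ {n} n∉ → unused (spare n n∉) ∘ ∈-resp-↭ σ
  ; redEdges = λ e∈ → Joined-sound h (All.lookup joined e∈)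
  ; enough = subst₂ (λ i j → m + i ℕ.≤ r + j) len (sym (↭-length σ)) enough
  }
  where
  open Holds h
  spare : ∀ n → n ∉ used q → rename π n ∉ used p
  spare n n∉ n∈ with rename-range π n
  ... | inj₁ (n< , _) = Sum.[ n∉ , (λ ∉p → ∉p n∈) ] (All.lookup apart (∈-upTo⁺ n<))
  ... | inj₂ (_ , 20≤) = <⇒≱ (All.lookup bounded n∈) 20≤

-- The strategy

data Hub : Set where
  plain twin spare tipped split hooked clasped : Hub

-- A name in `used` that is not an end, such as 3 in `spare` and `hooked` or 2 in `tipped` and
-- `clasped`, may lie inside the path or off it.
hub : Hub → Position
hub plain = position ((0 , 1) ∷ []) (0 ∷ 1 ∷ []) []
hub twin = position ((0 , 1) ∷ (2 , 3) ∷ []) (0 ∷ 1 ∷ 2 ∷ 3 ∷ []) []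
hub spare = position ((0 , 1) ∷ []) (0 ∷ 1 ∷ 3 ∷ []) ((2 , 3) ∷ [])
hub tipped = position ((0 , 1) ∷ []) (0 ∷ 1 ∷ 2 ∷ []) ((1 , 2) ∷ [])
hub split = position ((0 , 1) ∷ (2 , 3) ∷ []) (0 ∷ 1 ∷ 2 ∷ 3 ∷ []) ((3 , 4) ∷ [])
hub hooked = position ((0 , 1) ∷ []) (0 ∷ 1 ∷ 3 ∷ []) ((2 , 1) ∷ (2 , 3) ∷ [])
hub clasped = position ((0 , 1) ∷ []) (0 ∷ 1 ∷ 2 ∷ []) ((0 , 1) ∷ (0 , 2) ∷ [])

-- The offsets, and the trees main and tree, come from a computer search.
offset : Hub → ℕ
offset plain = 6
offset twin = 8
offset spare = 5
offset tipped = 5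
offset split = 3
offset hooked = 2
offset clasped = 2

-- Exceptions to the linear bound for small r. For instance, `twin` and `split` at r = 0 lack no
-- edge but still have two paths to merge.
extra : Hub → ℕ → ℕ
extra plain 1 = 1
extra twin 0 = 2
extra tipped 2 = 1
extra split 0 = 2
extra clasped 3 = 1
extra _ _ = 0

linear : ℕ → ℕ → ℕ
linear c r = (7 ℕ.* r + c) ℕ./ 5

rounds : Hub → ℕ → ℕ
rounds h r = linear (offset h) r + extra h r

-- won: there is a red P₄; done: a single path is left, long enough; ask: the
-- first subtree answers red, the second blue; goto renames the vertices of a hub.
data Tree : Set where
  won done : Tree
  goto : Hub → List ℕ → Tree
  ask : (u v : ℕ) → Tree → Tree → Tree

-- For edges whose red answer would complete a red P₄, so that Painter has to answer blue.
force : ℕ → ℕ → Tree → Tree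
force u v = ask u v won

-- Validity does not mention r: a tree shared by many r has the same validity condition for all of
-- them, and the counting is left to `Within`.
Valid : Tree → Position → Set
Valid won             p = RedP₄ (reds p)
Valid done            p = length (ends p) ≡ 1
Valid (goto h π)      p = Fits π (hub h) p
Valid (ask u v t₁ t₂) p = u ≢ v × Valid t₁ (redden u v p) × AnyM.Any (Valid t₂) (join u v p)

Valid? : ∀ t p → Dec (Valid t p)
Valid? won             p = RedP₄? (reds p)
Valid? done            p = length (ends p) ≟ 1
Valid? (goto h π)      p = Fits? π (hub h) p
Valid? (ask u v t₁ t₂) p = ¬? (u ≟ v) ×-dec Valid? t₁ (redden u v p) ×-dec AnyM.dec (Valid? t₂) (join u v p)

-- Within t r T: following t, Builder gains r blue edges in T rounds.
Within : Tree → ℕ → ℕ → Set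
Within won             r T       = ⊤
Within done            r T       = r ≡ 0
Within (goto h _)      r T       = rounds h r ℕ.≤ T
Within (ask _ _ t₁ t₂) r zero    = ⊥
Within (ask _ _ t₁ t₂) r (suc T) = Within t₁ r T × Within t₂ (pred r) T

Within? : ∀ t r T → Dec (Within t r T)
Within? won             r T       = yes tt
Within? done            r T       = r ≟ 0
Within? (goto h _)      r T       = rounds h r ≤? T
Within? (ask _ _ t₁ t₂) r zero    = no λ ()
Within? (ask _ _ t₁ t₂) r (suc T) = Within? t₁ r T ×-dec Within? t₂ (pred r) T

-- A hub's tree must not start with goto, lest the induction on rounds stall.
Proper : Tree → Set
Proper won        = ⊥
Proper (goto _ _) = ⊥
Proper _          = ⊤

Proper? : ∀ t → Dec (Proper t)
Proper? won = no λ ()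
Proper? done = yes tt
Proper? (goto _ _) = no λ ()
Proper? (ask _ _ _ _) = yes tt

-- Soundness of trees

Wins : ℕ → Hub → ℕ → Set
Wins m h r = ∀ {ρ b} → Holds m r (hub h) ρ b → Strategy (path 4) (path (suc m)) (rounds h r) b

-- With one path and nothing lacking, `enough` says that this path has at least m + 1 vertices.
done-sound : ∀ {m p ρ b} → length (ends p) ≡ 1 → Holds m 0 p ρ b → Copy (path (suc m)) b blue
done-sound {m} {p = position (_ ∷ []) _ _} refl
  record { lines = _∷_ {us = us} l [] ; distinct = distinct ; enough = enough } =
  path-copy (suc m) us
    (subst₂ ℕ._≤_ (+-comm m 1) (cong length (++-identityʳ us)) enough)
    (subst Unique (++-identityʳ us) distinct) (Line-linked l)

module _ {m : ℕ} where

  ask-sound : ∀ u v {t₁ t₂ p ρ b r T} →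
    (∀ {p ρ b r} → Valid t₁ p → Within t₁ r T → Holds m r p ρ b → Strategy (path 4) (path (suc m)) T b) →
    (∀ {p ρ b r} → Valid t₂ p → Within t₂ r T → Holds m r p ρ b → Strategy (path 4) (path (suc m)) T b) →
    Valid (ask u v t₁ t₂) p → Within (ask u v t₁ t₂) r (suc T) → Holds m r p ρ b →
    Strategy (path 4) (path (suc m)) (suc T) b
  ask-sound u v {ρ = ρ} {b} on-red on-blue (u≢v , valid₁ , valid₂) (within₁ , within₂) h =
    propose (ρ u) (ρ v) (u≢v ∘ Holds.injective h) λ
      { red  → on-red valid₁ within₁
                 (redden-sound u v (inj₁ (here refl)) (Holds-there h))
      ; blue → let q , h′ , valid = meet (join-sound u v (inj₂ (here refl)) (Holds-there h)) valid₂
               in on-blue valid within₂ h′ }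

  play : ∀ t {p ρ b r T} → (∀ h r → rounds h r ℕ.≤ T → Wins m h r) →
         Valid t p → Within t r T → Holds m r p ρ b → Strategy (path 4) (path (suc m)) T b
  play won  _ valid _ h = stop (inj₁ (RedP₄-sound h valid))
  play done _ valid refl h = stop (inj₂ (done-sound valid h))
  play (goto k π) {p} wins valid within h =
    Strategy-mono within (wins k _ within (Fits-sound π (hub k) p valid h))
  play (ask u v t₁ t₂) {T = suc T} wins = ask-sound u v
    (play t₁ λ k r le → wins k r (m≤n⇒m≤1+n le))
    (play t₂ λ k r le → wins k r (m≤n⇒m≤1+n le))

  -- The first question uses up a round, so every `goto` below it meets a bound strictly under T. A
  -- bare `goto` costs no round, which is why `play` assumes the hubs up to T itself.
  play-proper : ∀ t {p ρ b r T} → Proper t → (∀ h r → rounds h r < T → Wins m h r) →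
         Valid t p → Within t r T → Holds m r p ρ b → Strategy (path 4) (path (suc m)) T b
  play-proper done _ _ valid refl h = stop (inj₂ (done-sound valid h))
  play-proper (ask u v t₁ t₂) {T = suc T} _ wins = ask-sound u v
    (play t₁ λ k r le → wins k r (s≤s le))
    (play t₂ λ k r le → wins k r (s≤s le))

-- The trees of moves

main : Hub → Tree
main plain =
  ask 2 3
    (ask 2 4
       -- The leaves 3 and 4 of the red path 3-2-4 extend the blue path at both ends, and 2 stays
       -- off it. The potential is 6 - 5 - 5 + 3 * 2 = 2, the offset of `hooked`.
       (force 0 3 $ force 1 4 $ force 3 5 $ goto hooked (5 ∷ 4 ∷ 2 ∷ 3 ∷ []))
       (goto split (0 ∷ 1 ∷ 4 ∷ 2 ∷ 3 ∷ [])))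
    (goto twin (0 ∷ 1 ∷ 2 ∷ 3 ∷ []))
main twin = ask 0 4 (goto split (2 ∷ 3 ∷ 1 ∷ 0 ∷ 4 ∷ [])) (goto twin (1 ∷ 4 ∷ 2 ∷ 3 ∷ []))
main spare =
  ask 2 4
    (force 0 4 $ goto hooked (1 ∷ 4 ∷ 2 ∷ 3 ∷ []))
    (ask 2 5
       (force 0 5 $ force 4 5 $ goto plain (1 ∷ 2 ∷ []))
       (goto twin (0 ∷ 1 ∷ 4 ∷ 5 ∷ [])))
main tipped = ask 1 3 (force 0 3 $ goto clasped (1 ∷ 3 ∷ 2 ∷ [])) (goto plain (0 ∷ 3 ∷ []))
main split =
  ask 0 3
    -- The leaf 4 of the red path 0-3-4 links the two blue paths, leaving the centre 3 and the leaf
    -- 0 as ends of the merged path.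
    (force 2 4 $ force 1 4 $ goto clasped (3 ∷ 0 ∷ 4 ∷ []))
    (goto spare (1 ∷ 2 ∷ 4 ∷ 3 ∷ []))
main hooked =
  ask 4 5
    (force 2 4 $
     force 2 5 $
     ask 4 6
       (force 0 6 $ force 5 7 $ force 1 7 $ goto clasped (4 ∷ 6 ∷ 5 ∷ []))
       (force 1 6 $ goto tipped (0 ∷ 5 ∷ 4 ∷ [])))
    (force 1 4 $ goto plain (0 ∷ 5 ∷ []))
main clasped =
  ask 3 4
    (ask 3 5
       (force 0 3 $
        force 4 6 $ force 5 6 $ force 1 7 $ force 4 7 $ goto clasped (3 ∷ 5 ∷ 4 ∷ []))
       (force 0 4 $
        force 1 5 $
        ask 3 6
          (force 6 7 $ force 4 7 $ goto clasped (3 ∷ 6 ∷ 4 ∷ []))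
          (goto tipped (6 ∷ 4 ∷ 3 ∷ []))))
    (force 1 3 $ goto plain (0 ∷ 4 ∷ []))

tree : Hub → ℕ → Tree
tree plain 0 = done
tree plain 1 = ask 0 2 (goto tipped (1 ∷ 0 ∷ 2 ∷ [])) done
tree plain 2 = ask 2 3 (goto spare (0 ∷ 1 ∷ 2 ∷ 3 ∷ [])) (goto twin (0 ∷ 1 ∷ 2 ∷ 3 ∷ []))
-- After red answers on 0-2 and 1-3, a red 0-3 would complete the red path 2-0-3-1.
tree twin 0 = ask 0 2 (ask 1 3 (force 0 3 done) done) done
tree twin 1 = ask 0 2 (ask 1 3 (force 0 3 done) done) done
tree spare 0 = done
tree spare 1 = ask 0 2 (goto hooked (1 ∷ 0 ∷ 2 ∷ 3 ∷ [])) done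
tree spare 2 = ask 0 4 (force 2 4 $ force 0 2 done) (goto spare (1 ∷ 4 ∷ 2 ∷ 3 ∷ []))
tree spare 4 =
  ask 2 4 (force 0 4 $ goto hooked (1 ∷ 4 ∷ 2 ∷ 3 ∷ [])) (goto twin (0 ∷ 1 ∷ 2 ∷ 4 ∷ []))
tree tipped 0 = done
tree tipped 4 =
  ask 3 4
    (ask 3 5
       (force 0 4 $ force 1 5 $ force 4 6 $ goto hooked (6 ∷ 5 ∷ 3 ∷ 4 ∷ []))
       (goto split (0 ∷ 1 ∷ 5 ∷ 3 ∷ 4 ∷ [])))
    (goto twin (0 ∷ 1 ∷ 3 ∷ 4 ∷ []))
tree split 0 = ask 0 2 (force 0 3 done) done
tree split 1 = ask 0 2 (force 0 3 done) done
tree split 5 =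
  ask 3 5
    (force 0 4 $ force 2 5 $ force 1 5 $ goto clasped (3 ∷ 4 ∷ 5 ∷ []))
    (ask 0 6
       (force 0 4 $
        ask 2 7
          (force 2 6 $ force 4 7 $ force 6 7 done)
          (force 4 6 $ ask 1 5 (force 5 6 done) done))
       (goto twin (1 ∷ 6 ∷ 2 ∷ 5 ∷ [])))
tree hooked 0 = done
tree hooked 1 = force 1 4 done
tree hooked 2 = force 1 4 $ goto spare (0 ∷ 4 ∷ 2 ∷ 1 ∷ [])
tree hooked 3 = force 1 4 $ goto spare (0 ∷ 4 ∷ 2 ∷ 1 ∷ [])
tree hooked 4 = force 1 4 $ goto spare (0 ∷ 4 ∷ 2 ∷ 1 ∷ [])
tree hooked 6 =
  ask 4 5
    (force 2 4 $
     ask 4 6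
       (force 0 5 $ force 2 6 $ force 6 7 $ force 1 7 $ goto clasped (4 ∷ 5 ∷ 6 ∷ []))
       (force 1 6 $
        ask 2 7 (force 5 7 $ force 2 5 $ force 7 8 done) (goto spare (0 ∷ 7 ∷ 5 ∷ 4 ∷ []))))
    (force 1 4 $ goto plain (0 ∷ 5 ∷ []))
tree hooked 8 = force 1 4 $ goto spare (0 ∷ 4 ∷ 2 ∷ 1 ∷ [])
tree clasped 0 = done
tree clasped 1 = force 1 3 done
tree clasped 2 = force 1 3 $ goto tipped (3 ∷ 0 ∷ 1 ∷ [])
tree clasped 3 = force 1 3 $ goto tipped (3 ∷ 0 ∷ 1 ∷ [])
tree clasped 4 = force 1 3 $ goto tipped (3 ∷ 0 ∷ 1 ∷ [])
tree clasped 6 =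
  ask 3 4
    (ask 3 5
       (force 0 3 $
        force 4 6 $ force 5 6 $ force 1 7 $ force 4 7 $ goto clasped (3 ∷ 5 ∷ 4 ∷ []))
       (force 1 5 $
        ask 3 6
          (force 0 4 $ force 6 7 $ force 4 7 $ goto clasped (3 ∷ 6 ∷ 4 ∷ []))
          (ask 0 7
             (force 4 7 $ force 0 4 $ force 7 8 done)
             (goto spare (6 ∷ 7 ∷ 4 ∷ 3 ∷ [])))))
    (force 1 3 $ goto plain (0 ∷ 4 ∷ []))
tree clasped 8 = force 1 3 $ goto tipped (3 ∷ 0 ∷ 1 ∷ [])
-- The special values of r above are at most 8, so this clause covers all r from 9 on.
tree h _ = main h

-- The opening starts with potential 6; its leaves, in order, carry 2, 4, 5 and 8, against the
-- offsets 2, 2, 5 and 6 of the hubs reached.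
start : Tree
start =
  ask 0 1
    (ask 0 2
       (force 1 3 $ force 2 3 $ force 1 4 $ goto hooked (4 ∷ 2 ∷ 0 ∷ 1 ∷ []))
       (ask 0 3
          (force 1 2 $ force 3 4 $ force 1 4 $ goto clasped (0 ∷ 3 ∷ 1 ∷ []))
          (goto spare (2 ∷ 3 ∷ 1 ∷ 0 ∷ []))))
    (goto plain (0 ∷ 1 ∷ []))

-- Verification for small r and extension by periodicity

Sound : Hub → ℕ → Set
Sound h r = Proper (tree h r) × Valid (tree h r) (hub h) × Within (tree h r) r (rounds h r)

Sound? : ∀ h r → Dec (Sound h r)
Sound? h r = Proper? (tree h r) ×-dec Valid? (tree h r) (hub h) ×-dec Within? (tree h r) r (rounds h r)

-- Settled by evaluating the decision procedures; 14 = 9 + 5 takes in the special cases and one full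
-- period of the general trees.
sound-below : ∀ h {r} → r < 14 → Sound h r
sound-below plain = from-yes (allUpTo? (Sound? plain) 14)
sound-below twin = from-yes (allUpTo? (Sound? twin) 14)
sound-below spare = from-yes (allUpTo? (Sound? spare) 14)
sound-below tipped = from-yes (allUpTo? (Sound? tipped) 14)
sound-below split = from-yes (allUpTo? (Sound? split) 14)
sound-below hooked = from-yes (allUpTo? (Sound? hooked) 14)
sound-below clasped = from-yes (allUpTo? (Sound? clasped) 14)

-- Adding 5 to r lengthens the game by exactly 7 rounds, as long as the tree does
-- not run out of missing edges.
Steady : Tree → ℕ → Set
Steady done            _       = ⊥
Steady (ask _ _ _ _)   zero    = ⊥
Steady (ask _ _ t₁ t₂) (suc r) = Steady t₁ (suc r) × Steady t₂ r
Steady _               _       = ⊤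

linear-shift : ∀ c r → linear c (5 + r) ≡ 7 + linear c r
linear-shift c r = trans
  (cong (ℕ._/ 5) (trans (cong (_+ c) (*-distribˡ-+ 7 5 r)) (+-assoc 35 (7 ℕ.* r) c)))
  (+-distrib-/-∣ˡ {35} (7 ℕ.* r + c) {5} (divides 7 refl))

extra-vanishes : ∀ h r → extra h (5 + r) ≡ 0
extra-vanishes plain _ = refl
extra-vanishes twin _ = refl
extra-vanishes spare _ = refl
extra-vanishes tipped _ = refl
extra-vanishes split _ = refl
extra-vanishes hooked _ = refl
extra-vanishes clasped _ = refl

rounds-shift : ∀ h r → rounds h (5 + r) ≡ 7 + linear (offset h) r
rounds-shift h r = trans (cong₂ _+_ (linear-shift (offset h) r) (extra-vanishes h r)) (+-identityʳ _)

-- At `goto`, `extra` vanishes at 5 + r and can only have raised the bound at r. At `ask`,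
-- steadiness makes r positive, so `pred` commutes with adding 5.
Within-shift : ∀ t {r T} → Steady t r → Within t r T → Within t (5 + r) (7 + T)
Within-shift won        _ _ = tt
Within-shift (goto h _) {r} _ within =
  ≤-trans (≤-reflexive (rounds-shift h r)) (+-monoʳ-≤ 7 (≤-trans (m≤m+n _ _) within))
Within-shift (ask _ _ t₁ t₂) {suc r} {suc T} (steady₁ , steady₂) (within₁ , within₂) =
  Within-shift t₁ steady₁ within₁ , Within-shift t₂ steady₂ within₂

Within-periodic : ∀ t c → (∀ k → Steady t (9 + k)) →
                  (∀ {k} → k < 5 → Within t (9 + k) (linear c (9 + k))) →
                  ∀ k → Within t (9 + k) (linear c (9 + k))
Within-periodic t c steady base 0 = base (from-yes (0 <? 5))
Within-periodic t c steady base 1 = base (from-yes (1 <? 5))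
Within-periodic t c steady base 2 = base (from-yes (2 <? 5))
Within-periodic t c steady base 3 = base (from-yes (3 <? 5))
Within-periodic t c steady base 4 = base (from-yes (4 <? 5))
Within-periodic t c steady base (suc (suc (suc (suc (suc k))))) =
  subst (Within t (14 + k)) (sym (linear-shift c (9 + k)))
    (Within-shift t (steady k) (Within-periodic t c steady base k))

tree≡main : ∀ h k → tree h (9 + k) ≡ main h
tree≡main plain _ = refl
tree≡main twin _ = refl
tree≡main spare _ = refl
tree≡main tipped _ = refl
tree≡main split _ = refl
tree≡main hooked _ = refl
tree≡main clasped _ = refl

-- No branch of these trees gains more than five blue edges, so r stays positive throughout.
main-steady : ∀ h k → Steady (main h) (9 + k)
main-steady plain _ = _
main-steady twin _ = _
main-steady spare _ = _
main-steady tipped _ = _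
main-steady split _ = _
main-steady hooked _ = _
main-steady clasped _ = _

rounds≡linear : ∀ h k → rounds h (5 + k) ≡ linear (offset h) (5 + k)
rounds≡linear h k = trans (cong (λ e → linear (offset h) (5 + k) + e) (extra-vanishes h k)) (+-identityʳ _)

sound-above : ∀ h k → Sound h (9 + k)
sound-above h k rewrite tree≡main h k | rounds≡linear h (4 + k) =
  subst Proper (tree≡main h 0) (proj₁ below) ,
  subst (λ t → Valid t (hub h)) (tree≡main h 0) (proj₁ (proj₂ below)) ,
  Within-periodic (main h) (offset h) (main-steady h)
    (λ {j} j<5 → subst₂ (λ t T → Within t (9 + j) T) (tree≡main h j) (rounds≡linear h (4 + j))
      (proj₂ (proj₂ (sound-below h (+-monoʳ-< 9 j<5))))) k
  where below = sound-below h (from-yes (9 <? 14))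

sound : ∀ h r → Sound h r
sound h r with r <? 14
... | yes r<14 = sound-below h r<14
... | no  r≮14 = subst (Sound h) (ℕ.m+[n∸m]≡n (≤-trans (from-yes (9 ≤? 14)) (ℕ.≮⇒≥ r≮14)))
                   (sound-above h (r ℕ.∸ 9))

-- Hubs refer to one another cyclically, so the induction runs on the bound T for the number of
-- rounds left.
wins : ∀ {m} T h r → rounds h r < T → Wins m h r
wins (suc T) h r (s≤s le) = let proper , valid , within = sound h r in
  play-proper (tree h r) proper (λ k s lt → wins T k s (≤-trans lt le)) valid within

-- The opening and the final estimate

blank : Position
blank = position [] [] []

start-within : ∀ k → Within start (9 + k) (linear 6 (9 + k))
start-within = Within-periodic start 6 (λ _ → _)
  (from-yes (allUpTo? (λ k → Within? start (9 + k) (linear 6 (9 + k))) 5))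

builder-wins : ∀ k → BuilderWinsWithin (path 4) (path (10 + k)) (linear 6 (9 + k))
builder-wins k = play start {blank} (λ h r _ → wins _ h r ≤-refl)
  (from-yes (Valid? start blank)) (start-within k) record
  { injective = id ; lines = [] ; distinct = [] ; unused = λ _ () ; redEdges = λ ()
  ; enough = ≤-refl }

-- `ceiling` is the negative of the floor x of -7n/5. From 5x ≤ -7n follows 5l < 7n ≤ 5(-x), hence l
-- < -x.
ceiling-bound : ∀ l n → l ℕ.* 5 < 7 ℕ.* n → + l ≤ ceiling ((+ 7 / 5) * (+ n / 1)) - + 1
ceiling-bound l n 5l<7n = ℤ.≤-trans
  (ℤ.i<j⇒i≤pred[j] (ℤ.*-cancelʳ-<-nonNeg {+ l} {ℤ.- x} (+ 5) below))
  (ℤ.≤-reflexive (ℤ.+-comm (ℤ.- + 1) (ℤ.- x)))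
  where
  open ℤ.≤-Reasoning
  x = (ℤ.- (+ 7 ℤ.* + n)) ℤ./ + 5
  below : + l ℤ.* + 5 ℤ.< (ℤ.- x) ℤ.* + 5
  below = begin-strict
    + l ℤ.* + 5               ≡⟨ ℤ.pos-* l 5 ⟨
    + (l ℕ.* 5)               <⟨ ℤ.+<+ 5l<7n ⟩
    + (7 ℕ.* n)               ≡⟨ ℤ.pos-* 7 n ⟩
    + 7 ℤ.* + n               ≡⟨ ℤ.neg-involutive (+ 7 ℤ.* + n) ⟨
    ℤ.- (ℤ.- (+ 7 ℤ.* + n))   ≤⟨ ℤ.neg-mono-≤ (ℤ.[n/d]*d≤n (ℤ.- (+ 7 ℤ.* + n)) (+ 5)) ⟩
    ℤ.- (x ℤ.* + 5)           ≡⟨ ℤ.neg-distribˡ-* x (+ 5) ⟩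
    (ℤ.- x) ℤ.* + 5           ∎

-- The offset 6 enters here: 7m + 6 is just below 7(m + 1), where m = n - 1.
linear-bound : ∀ m → linear 6 m ℕ.* 5 < 7 ℕ.* suc m
linear-bound m = begin-strict
  linear 6 m ℕ.* 5  ≤⟨ m/n*n≤m (7 ℕ.* m + 6) 5 ⟩
  7 ℕ.* m + 6       <⟨ +-monoʳ-< (7 ℕ.* m) ≤-refl ⟩
  7 ℕ.* m + 7       ≡⟨ +-comm (7 ℕ.* m) 7 ⟩
  7 + 7 ℕ.* m       ≡⟨ *-suc 7 m ⟨
  7 ℕ.* suc m       ∎
  where open ℕ.≤-Reasoning

theorem1p4 : ∀ (n : ℕ) → n ≥ 10 →
    ∃[ r ] IsOnlineSizeRamseyNumber (path 4) (path n) r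
    × + r ≤ ceiling ((+ 7 / 5) * (+ n / 1)) - + 1
-- A path on n = 10 + k vertices has 9 + k edges, the range in which the bound for `start` is
-- established.
theorem1p4 n n≥10 with k , refl ← ℕ.m≤n⇒∃[o]m+o≡n n≥10 =
  let r , number , r≤ = least (path-searchable 2) (path-searchable (8 + k)) _ (builder-wins k)
  in r , number , ℤ.≤-trans (ℤ.+≤+ r≤) (ceiling-bound _ (10 + k) (linear-bound (9 + k)))
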